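{- There exists a $\mathbf{\Sigma}^1_1$-complete set in the class $\mathbf{r}\text{ - }\mathbf{BCL}(4)_\omega$.
   Context: **Blind counter automata.** For $k\ge 1$, a real time $k$-blind-counter machine is $\mathcal M=(K,\Sigma,\Delta,q_0)$ with $K$ a finite set of states, $\Sigma$ a finite alphabet, $q_0\in K$, and $\Delta\subseteq K\times\Sigma\times\{0,1\}^k\times K\times\{0,1,-1\}^k$, such that if $(q,a,i_1,\dots,i_k,q',j_1,\dots,j_k)\in\Delta$ and $i_m=0$ then $j_m\in\{0,1\}$, and the tuple obtained by replacing $i_m=0$ by $i_m=1$ (all other entries unchanged) is also in $\Delta$. Configurations are tuples $(q,c_1,\dots,c_k)$ with $q\in K$, $c_i\in\mathbb N$. Write $a:(q,c_1,\dots,c_k)\mapsto_{\mathcal M}(q',c_1+j_1,\dots,c_k+j_k)$ if $(q,a,i_1,\dots,i_k,q',j_1,\dots,j_k)\in\Delta$ where $i_m=0$ if $c_m=0$ and $i_m=1$ if $c_m>0$. A run on $\sigma=a_1a_2\cdots\in\Sigma^\omega$ is an infinite sequence of configurations $(r_i)_{i\ge1}$ with $r_1=(q_0,0,\dots,0)$ and $a_i:r_i\mapsto_{\mathcal M}r_{i+1}$ for all $i\ge1$. A (non-deterministic) real time Büchi $k$-blind-counter automaton is such a machine together with a set $F\subseteq K$; it accepts the set of $\sigma\in\Sigma^\omega$ having a run in which some state of $F$ occurs infinitely often. $\mathbf{r}\text{ - }\mathbf{BCL}(k)_\omega$ is the class of $\omega$-languages, over finite alphabets, accepted by these automata. **Topology.**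 $\Sigma^\omega$ carries the Cantor (product) topology; (boldface) $\mathbf\Sigma^1_1$ is the class of analytic sets (projections of Borel sets). A set $F\subseteq\Sigma^\omega$ is $\mathbf\Sigma^1_1$-complete iff for every finite alphabet $Y$ and every $E\subseteq Y^\omega$: $E\in\mathbf\Sigma^1_1$ iff there is a continuous $f:Y^\omega\to\Sigma^\omega$ with $E=f^{ -1}(F)$. -}

module Defs where

open import Axiom.ExcludedMiddle using (ExcludedMiddle)
open import Data.Bool.Base using (Bool; true; false; T)
open import Data.Fin.Base using (Fin)
open import Data.Fin.Subset using (Subset; _∈_)
open import Data.Integer.Base as ℤ using (ℤ; +_)
open import Data.List.Base using (List; length; applyUpTo)
open import Data.List.Properties using (length-applyUpTo)
open import Data.Nat.Base using (ℕ; zero; suc; _≥_)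
open import Data.Product.Base using (Σ-syntax; ∃; ∃-syntax; _×_; _,_; proj₁)
open import Data.Vec.Base using (Vec; lookup; map; replicate; _[_]≔_)
open import Function.Bundles using (_⇔_)
open import Level using (0ℓ) renaming (suc to lsuc)
open import Relation.Binary.PropositionalEquality using (_≡_; _≢_; cong; subst)
open import Relation.Nullary.Decidable.Core using (isYes; toWitness; fromWitness; decidable-stable)
open import Relation.Unary using (Pred; _≐_; _⊢_; ∁; ⋃; ⋂)

------------------------------------------------------------------------
-- Infinite words

-- The letter at position i ≥ 1 of a₁a₂a₃… is the value at i - 1.
infix 10 _ω

_ω : Set → Set
A ω = ℕ → A

prefix : ∀ {A : Set} → ℕ → A ω → List A
prefix n x = applyUpTo x n

Language : Set → Set₁
Language A = Pred (A ω) 0ℓ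

------------------------------------------------------------------------
-- Blind-counter automata

-- The changes 0, 1, -1 of a counter.
data Move : Set where
  stay inc dec : Move

⟦_⟧ : Move → ℤ
⟦ stay ⟧ = ℤ.0ℤ
⟦ inc  ⟧ = ℤ.1ℤ
⟦ dec  ⟧ = ℤ.-1ℤ

-- A real time k-blind-counter machine over the alphabet Fin n.  The finite
-- relation Δ is given by its characteristic function, and i_m ∈ {0,1} is
-- encoded with false for 0 and true for 1.
record Machine (k n : ℕ) : Set where
  field
    states : ℕ
    q₀     : Fin states
    Δ      : Fin states → Fin n → Vec Bool k → Fin states → Vec Move k → Bool
    no-dec-at-zero : ∀ {q a i q′ j} → T (Δ q a i q′ j) →
                     ∀ m → lookup i m ≡ false → lookup j m ≢ dec
    blind          : ∀ {q a i q′ j} → T (Δ q a i q′ j) →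
                     ∀ m → lookup i m ≡ false → T (Δ q a (i [ m ]≔ true) q′ j)

  Configuration : Set
  Configuration = Fin states × Vec ℕ k

  initial : Configuration
  initial = q₀ , replicate k 0

  positive : ℕ → Bool
  positive zero    = false
  positive (suc _) = true

  infix 4 _∶_↦_

  _∶_↦_ : Fin n → Configuration → Configuration → Set
  a ∶ (q , c) ↦ (q′ , c′) =
    ∃[ j ] T (Δ q a (map positive c) q′ j) ×
           (∀ m → + lookup c′ m ≡ + lookup c m ℤ.+ ⟦ lookup j m ⟧)

  IsRun : Fin n ω → Configuration ω → Set
  IsRun σ r = r 0 ≡ initial × (∀ i → σ i ∶ r i ↦ r (suc i))

InfinitelyOften : Pred ℕ 0ℓ → Set
InfinitelyOften P = ∀ n → ∃[ m ] m ≥ n × P m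

record BüchiAutomaton (k n : ℕ) : Set where
  field
    machine : Machine k n
  open Machine machine public
  field
    F : Subset states

  accepted : Language (Fin n)
  accepted σ = ∃[ r ] IsRun σ r ×
               (∃[ q ] q ∈ F × InfinitelyOften (λ i → proj₁ (r i) ≡ q))

r-BCL[_]ω : ∀ (k : ℕ) {n : ℕ} → Language (Fin n) → Set
r-BCL[ k ]ω {n} L = ∃[ A ] L ≐ BüchiAutomaton.accepted {k} {n} A

------------------------------------------------------------------------
-- Topology of A ω, for A finite

-- The open set W·A^ω generated by a set W of finite words.
_·ω : ∀ {A : Set} → (List A → Bool) → Language A
(W ·ω) x = ∃[ n ] T (W (prefix n x))

-- The smallest class of subsets of A ω that contains the open sets and the
-- closed sets and has countable unions and countable intersections.
--
-- Closure under complements is a consequence in classical logic (∁-borel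
-- below).  It is not a constructor, because taking complements at the open
-- level only leaves every Borel set with its positive content, which is what
-- makes the theory of analytic sets meaningful without excluded middle.
data Borel {A : Set} : Pred (Language A) (lsuc 0ℓ) where
  open-set     : (W : List A → Bool) → Borel (W ·ω)
  closed-set   : (W : List A → Bool) → Borel (∁ (W ·ω))
  union        : (B : ℕ → Language A) → (∀ n → Borel (B n)) → Borel (⋃ ℕ B)
  intersection : (B : ℕ → Language A) → (∀ n → Borel (B n)) → Borel (⋂ ℕ B)
  respects-≐   : {B C : Language A} → B ≐ C → Borel B → Borel C

-- Projections of Borel sets, with A ω × Z ω identified with (A × Z) ω for a
-- finite alphabet Z.
Analytic : ∀ {A : Set} → Language A → Set₁
Analytic {A} E =
  Σ[ z ∈ ℕ ] Σ[ B ∈ Language (A × Fin z) ]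
    Borel B × E ≐ (λ x → Σ[ y ∈ Fin z ω ] B (λ i → x i , y i))

Continuous : ∀ {A B : Set} → (A ω → B ω) → Set
Continuous f = ∀ x n → ∃[ m ] (∀ y → prefix m x ≡ prefix m y →
                                     prefix n (f x) ≡ prefix n (f y))

Σ¹₁-Complete : ∀ {n} → Language (Fin n) → Set₁
Σ¹₁-Complete {n} L =
  ∀ {m} (E : Language (Fin m)) →
  Analytic E ⇔ (Σ[ f ∈ (Fin m ω → Fin n ω) ] Continuous f × E ≐ (f ⊢ L))

------------------------------------------------------------------------
-- In classical logic, Borel is the σ-algebra generated by the topology: it
-- contains every open set in the sense of neighbourhoods, and is closed under
-- complements.

IsOpen : ∀ {A : Set} → Language A → Set
IsOpen U = ∀ x → U x → ∃[ n ] (∀ y → prefix n y ≡ prefix n x → U y)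

module _ (em : ExcludedMiddle 0ℓ) {A : Set} where

  isOpen-borel : {U : Language A} → IsOpen U → Borel U
  isOpen-borel {U} U-open = respects-≐ (from , to) (open-set W)
    where
    Inside : List A → Set
    Inside u = ∀ y → prefix (length u) y ≡ u → U y

    W : List A → Bool
    W u = isYes (em {Inside u})

    from : ∀ {x} → (W ·ω) x → U x
    from {x} (n , w) =
      toWitness {a? = em} w x (cong (λ l → prefix l x) (length-applyUpTo x n))

    to : ∀ {x} → U x → (W ·ω) x
    to {x} x∈U with n , nbhd ← U-open x x∈U = n , fromWitness {a? = em} inside
      where
      inside : Inside (prefix n x)
      inside y eq = nbhd y (subst (λ l → prefix l y ≡ prefix n x)
                                  (length-applyUpTo x n) eq)

  ∁-borel : {B : Language A} → Borel B → Borel (∁ B)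
  ∁-borel (open-set W)   = closed-set W
  ∁-borel (closed-set W) =
    respects-≐ ((λ x∈W ¬x∈W → ¬x∈W x∈W) , decidable-stable em) (open-set W)
  ∁-borel (union B bs) =
    respects-≐ ((λ f (n , b) → f n b) , (λ f n b → f (n , b)))
               (intersection (λ n → ∁ (B n)) (λ n → ∁-borel (bs n)))
  ∁-borel (intersection B bs) =
    respects-≐ ((λ (n , ¬b) f → ¬b (f n)) , to)
               (union (λ n → ∁ (B n)) (λ n → ∁-borel (bs n)))
    where
    to : ∀ {x} → ∁ (⋂ ℕ B) x → ⋃ ℕ (λ n → ∁ (B n)) x
    to ¬all = decidable-stable em λ ¬some →
      ¬all λ n → decidable-stable em λ ¬b → ¬some (n , ¬b)
  ∁-borel (respects-≐ (B⊆C , C⊆B) b) =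
    respects-≐ ((λ ¬b c → ¬b (C⊆B c)) , (λ ¬c b′ → ¬c (B⊆C b′))) (∁-borel b)

{-# OPTIONS --safe #-}

-- An analytic set has the form { x | ∃ α ∈ ℕ^ω, ∀ n, C n x α } with clopen
-- conditions C n, so x belongs to it iff a tree T(x) on ℕ, whose nodes are
-- decided by prefixes of x, has an infinite branch.  Number the nodes of
-- ℕ^{<ω} so that parents come first, and let the word of x consist of blocks,
-- one for each node t, giving the number of the parent of t in unary and
-- telling whether t lies in T(x).  A Büchi automaton guesses the blocks of a
-- branch.  It has to test that the node i selected last is the parent p of
-- the node t selected next.  At the block of t one counter holds i and another
-- t - i; the block subtracts p from the first and t - p from the second, so
-- that non-negativity of both forces i = p, and no zero test is needed.
--
-- Conversely, a run is a word over a finite alphabet, and the condition that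
-- it is an accepting run on f x is Borel: a continuous f is the pointwise
-- limit of the locally constant maps obtained by freezing x after l letters,
-- which avoids any appeal to excluded middle.

module Submission where

open import Defs
open import Data.Bool.Base using (Bool; true; false; T)
open import Data.Bool.Properties using () renaming (_≟_ to _≟ᵇ_)
open import Data.Fin.Base using (Fin; zero; suc; toℕ; combine; remQuot)
open import Data.Fin.Properties using (all?; toℕ-injective; remQuot-combine) renaming (_≟_ to _≟ᶠ_)
open import Data.Fin.Subset using (_∈_; ⁅_⁆)
open import Data.Fin.Subset.Properties using (_∈?_; x∈⁅x⁆; x∈⁅y⁆⇒x≡y)
open import Data.Integer.Base as ℤ using ()
open import Data.Integer.Properties using (+-injective)
open import Data.List.Base using (List; []; _∷_; length)
open import Data.List.Properties using (∷-injective; length-applyUpTo)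
open import Data.Nat.Base using (ℕ; zero; suc; pred; _+_; _*_; _∸_; _⊔_; _≤_; _<_; z≤n; s≤s)
open import Data.Nat.Properties
open import Data.Product.Base using (Σ-syntax; ∃; ∃-syntax; _×_; _,_; proj₁; proj₂)
open import Data.Sum.Base using (_⊎_; inj₁; inj₂)
open import Data.Unit.Base using (tt)
open import Data.Vec.Base using (Vec; []; _∷_; lookup; map; zipWith; _[_]≔_)
open import Data.Vec.Properties
  using (lookup∘update; lookup∘update′; ≡-dec; lookup-map; lookup-zipWith)
open import Function.Base using (_∘_; case_of_)
open import Function.Bundles using (mk⇔)
open import Relation.Binary.Definitions using (DecidableEquality)
open import Relation.Binary.PropositionalEquality
open import Relation.Nullary.Decidable
  using (Dec; yes; no; isYes; toWitness; fromWitness; T?; ¬?; _×-dec_; _→-dec_)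
open import Relation.Nullary.Negation using (contradiction)
open import Relation.Unary using (_≐_; _⊢_; _∩_)

-- Pairing of natural numbers

-- The walk through ℕ × ℕ along the antidiagonals.
successor : ℕ × ℕ → ℕ × ℕ
successor (zero  , b) = suc b , zero
successor (suc a , b) = a , suc b

unpair : ℕ → ℕ × ℕ
unpair zero    = zero , zero
unpair (suc n) = successor (unpair n)

unpair-sum-≤ : ∀ n → proj₁ (unpair n) + proj₂ (unpair n) ≤ n
unpair-sum-≤ zero    = z≤n
unpair-sum-≤ (suc n) with unpair n | unpair-sum-≤ n
... | zero  , b | b≤n = s≤s (≤-trans (≤-reflexive (+-identityʳ b)) b≤n)
... | suc a , b | a≤n = ≤-trans (≤-reflexive (+-suc a b)) (m≤n⇒m≤1+n a≤n)

-- The walk is traced backwards: `(a , suc b)` comes right after `(suc a , b)`, and `(suc s , zero)`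
-- right after `(zero , s)`, the end of the preceding antidiagonal. The recursion is lexicographic
-- in `s` and `b`.
unpair-surjective : ∀ s b a → a + b ≡ s → ∃[ n ] unpair n ≡ (a , b)
unpair-surjective s       (suc b) a       eq =
  let n , e = unpair-surjective s b (suc a) (trans (sym (+-suc a b)) eq)
  in suc n , cong successor e
unpair-surjective zero    zero    zero    _  = zero , refl
unpair-surjective (suc s) zero    (suc a) eq =
  let n , e = unpair-surjective s s zero refl
  in suc n , trans (cong successor e)
                   (cong (_, zero) (trans (sym eq) (+-identityʳ (suc a))))
unpair-surjective (suc s) zero    zero    ()
unpair-surjective zero    zero    (suc a) ()

pair : ℕ → ℕ → ℕ
pair a b = proj₁ (unpair-surjective (a + b) b a refl)

unpair-pair : ∀ a b → unpair (pair a b) ≡ (a , b)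
unpair-pair a b = proj₂ (unpair-surjective (a + b) b a refl)

π₁ π₂ : ℕ → ℕ
π₁ = proj₁ ∘ unpair
π₂ = proj₂ ∘ unpair

π₁-pair : ∀ a b → π₁ (pair a b) ≡ a
π₁-pair a b = cong proj₁ (unpair-pair a b)

π₂-pair : ∀ a b → π₂ (pair a b) ≡ b
π₂-pair a b = cong proj₂ (unpair-pair a b)

π₁-≤ : ∀ n → π₁ n ≤ n
π₁-≤ n = m+n≤o⇒m≤o (π₁ n) (unpair-sum-≤ n)

π₂-≤ : ∀ n → π₂ n ≤ n
π₂-≤ n = m+n≤o⇒n≤o (π₁ n) (unpair-sum-≤ n)

for-all-pairs : ∀ {P : ℕ → ℕ → Set} → (∀ N → P (π₁ N) (π₂ N)) → ∀ k n → P k n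
for-all-pairs {P} h k n =
  subst₂ P (π₁-pair k n) (π₂-pair k n) (h (pair k n))

-- Agreement of infinite words on prefixes

infix 4 _≈[_]_

_≈[_]_ : {A : Set} → A ω → ℕ → A ω → Set
x ≈[ n ] y = ∀ {i} → i < n → x i ≡ y i

≈-mono : ∀ {A : Set} {x y : A ω} {m n} → m ≤ n → x ≈[ n ] y → x ≈[ m ] y
≈-mono m≤n x≈y i<m = x≈y (<-≤-trans i<m m≤n)

≈⇒prefix : ∀ {A : Set} n {x y : A ω} → x ≈[ n ] y → prefix n x ≡ prefix n y
≈⇒prefix zero    x≈y = refl
≈⇒prefix (suc n) x≈y = cong₂ _∷_ (x≈y (s≤s z≤n)) (≈⇒prefix n (x≈y ∘ s≤s))

prefix⇒≈ : ∀ {A : Set} n {x y : A ω} → prefix n x ≡ prefix n y → x ≈[ n ] y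
prefix⇒≈ (suc n) eq {zero}  _         = proj₁ (∷-injective eq)
prefix⇒≈ (suc n) eq {suc i} (s≤s i<n) = prefix⇒≈ n (proj₂ (∷-injective eq)) i<n

reindexing-modulus : (g : ℕ → ℕ) → ℕ → ℕ
reindexing-modulus g zero    = zero
reindexing-modulus g (suc n) = suc (g n) ⊔ reindexing-modulus g n

reindexing-≈ : ∀ {A : Set} (g : ℕ → ℕ) n {x y : A ω} →
               x ≈[ reindexing-modulus g n ] y → x ∘ g ≈[ n ] y ∘ g
reindexing-≈ g (suc n) x≈y (s≤s i≤n) with m≤n⇒m<n∨m≡n i≤n
... | inj₁ i<n  = reindexing-≈ g n
  (λ j< → x≈y (<-≤-trans j< (m≤n⊔m (suc (g n)) (reindexing-modulus g n)))) i<n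
... | inj₂ refl = x≈y (m≤m⊔n (suc (g n)) (reindexing-modulus g n))

guard : ∀ {P : Set} → Dec P → Bool → Bool
guard P? b = isYes (P? →-dec T? b)

guard-intro : ∀ {P : Set} (P? : Dec P) {b} → (P → T b) → T (guard P? b)
guard-intro P? {b} = fromWitness {a? = P? →-dec T? b}

guard-elim : ∀ {P : Set} (P? : Dec P) {b} → T (guard P? b) → P → T b
guard-elim P? {b} = toWitness {a? = P? →-dec T? b}

-- The premise may be used in comparing the two Booleans; `alive-local` gets from it the bound that
-- the guard checks.
guard-cong : ∀ {P : Set} (P? : Dec P) {b c} → (P → b ≡ c) → guard P? b ≡ guard P? c
guard-cong (yes p) b≡c = cong (guard (yes p)) (b≡c p)
guard-cong (no ¬p) _   = refl

-- Souslin form of Borel and analytic sets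

-- E is the projection of a closed set of A ω × ℕ ω, given by countably many
-- clopen conditions.
record Souslin {A : Set} (E : Language A) : Set where
  field
    check   : ℕ → A ω → ℕ ω → Bool
    modulus : ℕ → ℕ
    local   : ∀ n {x x′ α α′} → x ≈[ modulus n ] x′ → α ≈[ modulus n ] α′ →
              check n x α ≡ check n x′ α′
    witness : ∀ {x} → E x → ∃[ α ] ∀ n → T (check n x α)
    member  : ∀ {x} α → (∀ n → T (check n x α)) → E x

open Souslin

prepend : ℕ → ℕ ω → ℕ ω
prepend k α zero    = k
prepend k α (suc i) = α i

-- `α` stores the evidence for membership: for an open set the length of a prefix in `W`, for a
-- union an index followed by evidence for that member, for an intersection one column of evidence
-- for each member.
borel⇒souslin : ∀ {A : Set} {B : Language A} → Borel B → Souslin B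
borel⇒souslin (open-set W) = record
  { check   = λ n x α → guard (α 0 ≟ n) (W (prefix n x))
  -- Condition 0 already reads `α 0`.
  ; modulus = suc
  ; local   = λ n x≈x′ α≈α′ →
      cong₂ (λ k u → guard (k ≟ n) (W u)) (α≈α′ (s≤s z≤n))
            (≈⇒prefix n (≈-mono (n≤1+n n) x≈x′))
  ; witness = λ {x} (m , w) → (λ _ → m) , λ n →
      guard-intro (m ≟ n) λ m≡n → subst (λ k → T (W (prefix k x))) m≡n w
  ; member  = λ α h → α 0 , guard-elim (α 0 ≟ α 0) (h (α 0)) refl
  }
borel⇒souslin (closed-set W) = record
  { check   = λ n x _ → isYes (¬? (T? (W (prefix n x))))
  ; modulus = λ n → n
  ; local   = λ n x≈x′ _ → cong (λ u → isYes (¬? (T? (W u)))) (≈⇒prefix n x≈x′)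
  ; witness = λ ¬w → (λ _ → 0) , λ n → fromWitness (λ w → ¬w (n , w))
  ; member  = λ _ h (n , w) → toWitness (h n) w
  }
borel⇒souslin (union B bs) = record
  { check   = λ N x α → guard (α 0 ≟ π₁ N) (check (S (π₁ N)) (π₂ N) x (α ∘ suc))
  ; modulus = λ N → suc (modulus (S (π₁ N)) (π₂ N))
  ; local   = λ N x≈x′ α≈α′ →
      cong₂ (λ k → guard (k ≟ π₁ N)) (α≈α′ (s≤s z≤n))
            (local (S (π₁ N)) (π₂ N) (≈-mono (n≤1+n _) x≈x′) (α≈α′ ∘ s≤s))
  ; witness = λ {x} (k , b) → let α , h = witness (S k) b in
      prepend k α , λ N → guard-intro (k ≟ π₁ N) λ k≡ →
        subst (λ k′ → T (check (S k′) (π₂ N) x α)) k≡ (h (π₂ N))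
  ; member  = λ {x} α h → α 0 , member (S (α 0)) (α ∘ suc) λ n →
      for-all-pairs {P = λ k n → α 0 ≡ k → T (check (S k) n x (α ∘ suc))}
                    (λ N → guard-elim (α 0 ≟ π₁ N) (h N)) (α 0) n refl
  }
  where
  S : ∀ n → Souslin (B n)
  S n = borel⇒souslin (bs n)
borel⇒souslin (intersection B bs) = record
  { check   = λ N x α → check (S (π₁ N)) (π₂ N) x (α ∘ pair (π₁ N))
  ; modulus = λ N → modulus (S (π₁ N)) (π₂ N) ⊔
                    reindexing-modulus (pair (π₁ N)) (modulus (S (π₁ N)) (π₂ N))
  ; local   = λ N x≈x′ α≈α′ →
      local (S (π₁ N)) (π₂ N) (≈-mono (m≤m⊔n _ _) x≈x′)
            (reindexing-≈ (pair (π₁ N)) _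
              (≈-mono (m≤n⊔m (modulus (S (π₁ N)) (π₂ N)) _) α≈α′))
  ; witness = λ {x} b →
      let α : ℕ → ℕ ω
          α k = proj₁ (witness (S k) (b k))
          β : ℕ ω
          β N = α (π₁ N) (π₂ N)
      -- The columns of `β` equal the chosen witnesses only entry by entry, so `local` transports
      -- the check.
      in β , λ N → subst T
           (local (S (π₁ N)) (π₂ N) (λ _ → refl)
             λ {i} _ → sym (cong₂ α (π₁-pair (π₁ N) i) (π₂-pair (π₁ N) i)))
           (proj₂ (witness (S (π₁ N)) (b (π₁ N))) (π₂ N))
  ; member  = λ {x} α h k → member (S k) (α ∘ pair k) λ n →
      for-all-pairs {P = λ k n → T (check (S k) n x (α ∘ pair k))} h k n
  }
  where
  S : ∀ n → Souslin (B n)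
  S n = borel⇒souslin (bs n)
borel⇒souslin (respects-≐ (B⊆C , C⊆B) b) = record
  { check   = check S
  ; modulus = modulus S
  ; local   = local S
  ; witness = λ c → witness S (C⊆B c)
  ; member  = λ α h → B⊆C (member S α h)
  }
  where
  S = borel⇒souslin b

-- A retraction of ℕ onto the alphabet, so that every `α` decodes to a word.
clamp : ∀ {z} → ℕ → Fin (suc z)
clamp {zero}  _       = zero
clamp {suc z} zero    = zero
clamp {suc z} (suc n) = suc (clamp n)

clamp-toℕ : ∀ {z} (i : Fin (suc z)) → clamp (toℕ i) ≡ i
clamp-toℕ {zero}  zero    = refl
clamp-toℕ {suc z} zero    = refl
clamp-toℕ {suc z} (suc i) = cong suc (clamp-toℕ i)

-- One entry of the new `α` codes a letter of the projected word together with an entry of the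
-- evidence for `B`.
analytic⇒souslin : ∀ {A : Set} {E : Language A} → Analytic E → Souslin E
-- There is no infinite word over `Fin 0`, so `E` is empty.
analytic⇒souslin (zero , B , b , E⊆ , ⊆E) = record
  { check   = λ _ _ _ → false
  ; modulus = λ _ → 0
  ; local   = λ _ _ _ → refl
  ; witness = λ e → case proj₁ (E⊆ e) 0 of λ ()
  ; member  = λ _ h → case h 0 of λ ()
  }
analytic⇒souslin {E = E} (suc z , B , b , E⊆ , ⊆E) = record
  { check   = λ n x α → check S n (λ i → x i , clamp (π₁ (α i))) (π₂ ∘ α)
  ; modulus = modulus S
  ; local   = λ n x≈x′ α≈α′ →
      local S n (λ i< → cong₂ (λ a k → a , clamp (π₁ k)) (x≈x′ i<) (α≈α′ i<))
                (λ i< → cong π₂ (α≈α′ i<))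
  ; witness = λ {x} e →
      let y , b′ = E⊆ e
          α , h  = witness S b′
          code   = λ i → pair (toℕ (y i)) (α i)
      in code , λ n → subst T
           (local S n
             (λ {i} _ → cong (x i ,_) (sym (trans (cong clamp (π₁-pair (toℕ (y i)) (α i)))
                                                  (clamp-toℕ (y i)))))
             (λ {i} _ → sym (π₂-pair (toℕ (y i)) (α i))))
           (h n)
  ; member  = λ α h → ⊆E (_ , member S (π₂ ∘ α) h)
  }
  where
  S = borel⇒souslin b

-- The upper bound

pad : {A : Set} → A → List A → A ω
pad a []      i       = a
pad a (b ∷ l) zero    = b
pad a (b ∷ l) (suc i) = pad a l i

pad-prefix : ∀ {A : Set} (a : A) n x → pad a (prefix n x) ≈[ n ] x
pad-prefix a (suc n) x {zero}  _         = refl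
pad-prefix a (suc n) x {suc i} (s≤s i<n) = pad-prefix a n (x ∘ suc) i<n

-- The first `N` letters decide `φ`, so the set is generated by the words of length `suc N` whose
-- padding satisfies `φ`.
borel-clopen : ∀ {A : Set} (φ : A ω → Bool) N → (∀ {x y} → x ≈[ N ] y → φ x ≡ φ y) →
               Borel (T ∘ φ)
borel-clopen {A} φ N φ-local = respects-≐ (from , to) (open-set W)
  where
  holds? : ∀ a u → Dec (length u ≡ suc N × T (φ (pad a u)))
  holds? a u = (length u ≟ suc N) ×-dec T? (φ (pad a u))

  W : List A → Bool
  -- The empty word offers no letter to pad with. Length `suc N` instead of `N` keeps the generating
  -- words nonempty.
  W []      = false
  W (a ∷ l) = isYes (holds? a (a ∷ l))

  φ-pad : ∀ x → φ (pad (x 0) (prefix (suc N) x)) ≡ φ x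
  φ-pad x = φ-local (≈-mono (n≤1+n N) (pad-prefix (x 0) (suc N) x))

  from : ∀ {x} → (W ·ω) x → T (φ x)
  from {x} (suc n , w) with toWitness {a? = holds? (x 0) (prefix (suc n) x)} w
  ... | len , t = subst T (φ-pad x)
    (subst (λ k → T (φ (pad (x 0) (prefix k x)))) (trans (sym (length-applyUpTo x (suc n))) len) t)

  to : ∀ {x} → T (φ x) → (W ·ω) x
  to {x} t = suc N , fromWitness {a? = holds? (x 0) (prefix (suc N) x)}
    (length-applyUpTo x (suc N) , subst T (sym (φ-pad x)) t)

borel-∩ : ∀ {A : Set} {B C : Language A} → Borel B → Borel C → Borel (B ∩ C)
borel-∩ {A} {B} {C} b c =
  respects-≐ ((λ h → h 0 , h 1) , λ { (p , q) zero → p ; (p , q) (suc _) → q })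
             (intersection D λ { zero → b ; (suc _) → c })
  where
  D : ℕ → Language A
  D zero    = B
  D (suc _) = C

-- Finite alphabets and counter moves

record Finite (S : Set) : Set where
  field
    size          : ℕ
    encode        : S → Fin size
    decode        : Fin size → S
    decode-encode : ∀ s → decode (encode s) ≡ s

open Finite

finite-Fin : ∀ n → Finite (Fin n)
finite-Fin n = record
  { size = n ; encode = λ i → i ; decode = λ i → i ; decode-encode = λ _ → refl }

finite-× : ∀ {S R : Set} → Finite S → Finite R → Finite (S × R)
finite-× U V = record
  { size          = size U * size V
  ; encode        = λ (s , r) → combine (encode U s) (encode V r)
  ; decode        = λ i → let j , k = remQuot (size V) i in decode U j , decode V k
  ; decode-encode = λ (s , r) →
      trans (cong (λ (j , k) → decode U j , decode V k) (remQuot-combine (encode U s) (encode V r)))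
            (cong₂ _,_ (decode-encode U s) (decode-encode V r))
  }

finite-Vec : ∀ {S : Set} → Finite S → ∀ n → Finite (Vec S n)
finite-Vec U zero = record
  { size = 1 ; encode = λ _ → zero ; decode = λ _ → [] ; decode-encode = λ { [] → refl } }
finite-Vec U (suc n) = record
  { size          = size V
  ; encode        = λ { (s ∷ v) → encode V (s , v) }
  ; decode        = λ i → let s , v = decode V i in s ∷ v
  ; decode-encode = λ { (s ∷ v) → cong (λ (s , v) → s ∷ v) (decode-encode V (s , v)) }
  }
  where
  V = finite-× U (finite-Vec U n)

finite-Move : Finite Move
finite-Move = record
  { size          = 3
  ; encode        = λ { stay → zero ; inc → suc zero ; dec → suc (suc zero) }
  ; decode        = λ { zero → stay ; (suc zero) → inc ; (suc (suc zero)) → dec }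
  ; decode-encode = λ { stay → refl ; inc → refl ; dec → refl }
  }

-- The integer equation of a move, read in ℕ; for `dec` it includes that `c` is positive.
Shift : Move → ℕ → ℕ → Set
Shift stay c c′ = c′ ≡ c
Shift inc  c c′ = c′ ≡ suc c
Shift dec  c c′ = c ≡ suc c′

shift : ∀ j {c c′} → ℤ.+ c′ ≡ ℤ.+ c ℤ.+ ⟦ j ⟧ → Shift j c c′
shift stay {c} eq = trans (+-injective eq) (+-identityʳ c)
shift inc  {c} eq = trans (+-injective eq) (+-comm c 1)
shift dec  {suc c} eq = cong suc (sym (+-injective eq))

unshift : ∀ j {c c′} → Shift j c c′ → ℤ.+ c′ ≡ ℤ.+ c ℤ.+ ⟦ j ⟧
unshift stay {c} refl = cong ℤ.+_ (sym (+-identityʳ c))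
unshift inc  {c} refl = cong ℤ.+_ (+-comm 1 c)
unshift dec      refl = refl

-- Truncation at 0 never shows in a run: by `no-dec-at-zero`, a transition that fires does not
-- decrement an empty counter.
move : ℕ → Move → ℕ
move c stay = c
move c inc  = suc c
move c dec  = pred c

move-unique : ∀ j {c c′} → ℤ.+ c′ ≡ ℤ.+ c ℤ.+ ⟦ j ⟧ → c′ ≡ move c j
move-unique stay eq = shift stay eq
move-unique inc  eq = shift inc eq
move-unique dec {c} eq = cong pred (sym (shift dec {c} eq))

lookup-injective : ∀ {S : Set} {n} (u v : Vec S n) → (∀ i → lookup u i ≡ lookup v i) → u ≡ v
lookup-injective []      []      _  = refl
lookup-injective (_ ∷ u) (_ ∷ v) eq =
  cong₂ _∷_ (eq zero) (lookup-injective u v (eq ∘ suc))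

-- A run is determined by the states entered and the moves made, which are
-- guessed as a word y over a finite alphabet.
module Runs {k n} (𝒜 : BüchiAutomaton k n) where

  open BüchiAutomaton 𝒜

  choice : Finite (Fin states × Vec Move k)
  choice = finite-× (finite-Fin states) (finite-Vec finite-Move k)

  Guess : Set
  Guess = Fin (size choice)

  entered : Guess ω → ℕ → Fin states
  entered y i = proj₁ (decode choice (y i))

  moves : Guess ω → ℕ → Vec Move k
  moves y i = proj₂ (decode choice (y i))

  conf : Guess ω → ℕ → Configuration
  conf y zero    = initial
  conf y (suc i) = entered y i , zipWith move (proj₂ (conf y i)) (moves y i)

  conf-local : ∀ {y y′} i → y ≈[ i ] y′ → conf y i ≡ conf y′ i
  conf-local zero    y≈y′ = refl
  conf-local (suc i) y≈y′ =
    cong₂ (λ (_ , c) g → proj₁ (decode choice g) , zipWith move c (proj₂ (decode choice g)))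
          (conf-local i (≈-mono (n≤1+n i) y≈y′)) (y≈y′ ≤-refl)

  fires : Fin n → Configuration → Guess → Bool
  fires a (q , c) g = let q′ , j = decode choice g in Δ q a (map positive c) q′ j

  Fires : Fin n ω → Guess ω → Set
  Fires σ y = ∀ i → T (fires (σ i) (conf y i) (y i))

  visits : ℕ → Configuration → Bool
  visits s (q , _) = isYes ((toℕ q ≟ s) ×-dec (q ∈? F))

  -- The state is named by a number, so that only unions and intersections indexed by ℕ occur, as
  -- `Borel` provides.
  Recurs : Guess ω → Set
  Recurs y = ∃[ s ] ∀ N → ∃[ M ] T (visits s (conf y (N + M)))

  module _ {σ : Fin n ω} {y : Guess ω} where

    fires⇒run : Fires σ y → IsRun σ (conf y)
    fires⇒run h = refl , λ i → moves y i , h i , λ m →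
      trans (cong ℤ.+_ (lookup-zipWith move m (proj₂ (conf y i)) (moves y i)))
            (moved (lookup (proj₂ (conf y i)) m) (lookup (moves y i) m)
              λ z → no-dec-at-zero (h i) m
                (trans (lookup-map m positive (proj₂ (conf y i))) (cong positive z)))
      where
      moved : ∀ c j → (c ≡ 0 → j ≢ dec) → ℤ.+ move c j ≡ ℤ.+ c ℤ.+ ⟦ j ⟧
      moved c       stay _ = unshift stay {c} refl
      moved c       inc  _ = unshift inc {c} refl
      moved zero    dec  z = contradiction refl (z refl)
      moved (suc c) dec  _ = refl

    recurs⇒accepted : Fires σ y → Recurs y → accepted σ
    recurs⇒accepted h (s , io) = conf y , fires⇒run h , q₁ , proj₂ visit₀ , λ N →
      let M , t = io N
          q≡s , _ = toWitness t
      in N + M , m≤m+n N M , toℕ-injective (trans q≡s (sym (proj₁ visit₀)))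
      where
      -- The first visit turns the number `s` into a state of `F`; all later visits are to the same
      -- state.
      q₁ = proj₁ (conf y (proj₁ (io 0)))
      visit₀ = toWitness {a? = (toℕ q₁ ≟ s) ×-dec (q₁ ∈? F)} (proj₂ (io 0))

  accepted⇒guess : ∀ {σ} → accepted σ → ∃[ y ] Fires σ y × Recurs y
  accepted⇒guess {σ} (r , (r₀ , steps) , q , q∈F , io) = y , fired , toℕ q , λ N →
    let m , m≥N , eq = io N
        rest = m ∸ N
        m≡ = m+[n∸m]≡n m≥N
        q≡ = trans (cong (λ i → proj₁ (conf y i)) m≡) (trans (cong proj₁ (conf≡r m)) eq)
    in rest , fromWitness (cong toℕ q≡ , subst (_∈ F) (sym q≡) q∈F)
    where
    y : Guess ω
    y i = encode choice (proj₁ (r (suc i)) , proj₁ (steps i))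

    conf≡r : ∀ i → conf y i ≡ r i
    conf≡r zero    = sym r₀
    conf≡r (suc i) =
      let j , _ , eq = steps i in
      trans (cong₂ (λ (_ , c) (q′ , j) → q′ , zipWith move c j)
                   (conf≡r i) (decode-encode choice (proj₁ (r (suc i)) , j)))
        (cong (proj₁ (r (suc i)) ,_) (lookup-injective _ _ λ m →
          trans (lookup-zipWith move m (proj₂ (r i)) j) (sym (move-unique (lookup j m) (eq m)))))

    fired : Fires σ y
    fired i = let j , δ , _ = steps i in
      subst T (sym (cong₂ (λ (q , c) (q′ , j) → Δ q (σ i) (map positive c) q′ j)
                          (conf≡r i) (decode-encode choice (proj₁ (r (suc i)) , j)))) δ

  module _ {m} (f : Fin m ω → Fin n ω) (f-continuous : Continuous f) where

    -- The padding letter is taken from `x` itself, since `Fin m` may be empty.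
    approx : ℕ → Fin m ω → Fin n ω
    approx l x = f (pad (x 0) (prefix l x))

    approx-limit : ∀ x i → ∃[ L ] ∀ l → L ≤ l → approx l x i ≡ f x i
    approx-limit x i = let L , h = f-continuous x (suc i) in L , λ l L≤l →
      sym (prefix⇒≈ (suc i) {f x} {approx l x} (h _ (≈⇒prefix L λ j<L →
        sym (pad-prefix (x 0) l x (<-≤-trans j<L L≤l)))) ≤-refl)

    Accepts : Language (Fin m × Guess)
    Accepts = (λ w → Fires (f (proj₁ ∘ w)) (proj₂ ∘ w)) ∩ (λ w → Recurs (proj₂ ∘ w))

    -- The modulus of `f` varies with the point, so no single clopen condition is at hand. But `ψ l`
    -- takes the right value for all large `l`, so the condition says that `ψ l` holds from some `L`
    -- on.
    borel-fires : ∀ i → Borel λ (w : (Fin m × Guess) ω) →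
                  T (fires (f (proj₁ ∘ w) i) (conf (proj₂ ∘ w) i) (proj₂ (w i)))
    borel-fires i = respects-≐ (from , to)
      (union _ λ L → intersection _ λ l →
        -- This covers the letters below `L + l`, the guess at `i`, and the padding letter at 0.
        borel-clopen (ψ (L + l)) (suc ((L + l) ⊔ i)) (ψ-local (L + l)))
      where
      ψ : ℕ → (Fin m × Guess) ω → Bool
      ψ l w = fires (approx l (proj₁ ∘ w) i) (conf (proj₂ ∘ w) i) (proj₂ (w i))

      ψ-local : ∀ l {v w} → v ≈[ suc (l ⊔ i) ] w → ψ l v ≡ ψ l w
      ψ-local l {v} {w} v≈w
        rewrite v≈w {0} (s≤s z≤n)
              | ≈⇒prefix l {proj₁ ∘ v} {proj₁ ∘ w}
                  (λ j<l → cong proj₁ (v≈w (m<n⇒m<1+n (<-≤-trans j<l (m≤m⊔n l i)))))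
              | conf-local {proj₂ ∘ v} {proj₂ ∘ w} i
                  (λ j<i → cong proj₂ (v≈w (m<n⇒m<1+n (<-≤-trans j<i (m≤n⊔m l i)))))
              | v≈w {i} (s≤s (m≤n⊔m l i)) = refl

      limit : ∀ {w l} → proj₁ (approx-limit (proj₁ ∘ w) i) ≤ l →
              ψ l w ≡ fires (f (proj₁ ∘ w) i) (conf (proj₂ ∘ w) i) (proj₂ (w i))
      limit {w} L≤l = cong (λ a → fires a (conf (proj₂ ∘ w) i) (proj₂ (w i)))
                           (proj₂ (approx-limit (proj₁ ∘ w) i) _ L≤l)

      from : ∀ {w} → (∃[ L ] ∀ l → T (ψ (L + l) w)) →
             T (fires (f (proj₁ ∘ w) i) (conf (proj₂ ∘ w) i) (proj₂ (w i)))
      -- The index used is `L` plus the bound of `approx-limit`, which lies beyond both.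
      from {w} (L , h) = subst T (limit {w} (m≤n+m _ L)) (h _)

      to : ∀ {w} → T (fires (f (proj₁ ∘ w) i) (conf (proj₂ ∘ w) i) (proj₂ (w i))) →
           ∃[ L ] ∀ l → T (ψ (L + l) w)
      to {w} t = proj₁ (approx-limit (proj₁ ∘ w) i) , λ l →
        subst T (sym (limit {w} (m≤m+n _ l))) t

    borel-recurs : Borel λ (w : (Fin m × Guess) ω) → Recurs (proj₂ ∘ w)
    borel-recurs = union _ λ s → intersection _ λ N → union _ λ M →
      borel-clopen (λ w → visits s (conf (proj₂ ∘ w) (N + M))) (N + M)
        (λ v≈w → cong (visits s) (conf-local (N + M) (λ j< → cong proj₂ (v≈w j<))))

    analytic-preimage : Analytic (f ⊢ accepted)
    analytic-preimage = size choice , Accepts ,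
      borel-∩ (intersection _ borel-fires) borel-recurs ,
      (λ acc → accepted⇒guess acc) , λ (y , fired , recurs) → recurs⇒accepted fired recurs

analytic-respects-≐ : ∀ {A : Set} {E E′ : Language A} → E′ ≐ E → Analytic E → Analytic E′
analytic-respects-≐ (E′⊆E , E⊆E′) (z , B , b , E⊆ , ⊆E) =
  z , B , b , (λ e → E⊆ (E′⊆E e)) , λ p → E⊆E′ (⊆E p)

-- Trees and branches

-- The nodes of ℕ^{<ω} are numbered so that 0 is the root and suc t is the
-- child number π₂ t of π₁ t.  A node is read as the list of its entries, the
-- last one first.  The first argument of entries bounds the recursion.
entries : ℕ → ℕ → List ℕ
entries zero    _       = []
entries (suc f) zero    = []
entries (suc f) (suc t) = π₂ t ∷ entries f (π₁ t)

label : ℕ → List ℕ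
label t = entries t t

entries-stable : ∀ f g {t} → t ≤ f → t ≤ g → entries f t ≡ entries g t
entries-stable zero    zero    z≤n z≤n = refl
entries-stable zero    (suc g) z≤n z≤n = refl
entries-stable (suc f) zero    z≤n z≤n = refl
entries-stable (suc f) (suc g) {zero}  _ _ = refl
entries-stable (suc f) (suc g) {suc t} (s≤s t≤f) (s≤s t≤g) =
  cong (π₂ t ∷_) (entries-stable f g (≤-trans (π₁-≤ t) t≤f) (≤-trans (π₁-≤ t) t≤g))

label-suc : ∀ t → label (suc t) ≡ π₂ t ∷ label (π₁ t)
label-suc t = cong (π₂ t ∷_) (entries-stable t (π₁ t) (π₁-≤ t) ≤-refl)

entries-length : ∀ f t → length (entries f t) ≤ f
entries-length zero    _       = z≤n
entries-length (suc f) zero    = z≤n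
entries-length (suc f) (suc t) = s≤s (entries-length f (π₁ t))

-- The head is the last entry, so its position is the length of the tail. The 0 beyond the list is a
-- default: the guard in `test` admits only checks that read within the list.
extend : List ℕ → ℕ ω
extend []      i = 0
extend (k ∷ l) i with i ≟ length l
... | yes _ = k
... | no  _ = extend l i

stack : ℕ ω → ℕ → List ℕ
stack γ zero    = []
stack γ (suc n) = γ n ∷ stack γ n

length-stack : ∀ γ n → length (stack γ n) ≡ n
length-stack γ zero    = refl
length-stack γ (suc n) = cong suc (length-stack γ n)

extend-stack : ∀ γ n → extend (stack γ n) ≈[ n ] γ
extend-stack γ (suc n) {i} (s≤s i≤n) with i ≟ length (stack γ n)
... | yes eq = cong γ (sym (trans eq (length-stack γ n)))
... | no neq = extend-stack γ n
                 (≤∧≢⇒< i≤n λ i≡n → neq (trans i≡n (sym (length-stack γ n))))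

-- Liveness is asked from the first child on, because a play starts with the root as the last
-- selected node.
record Branch (alive : ℕ → Bool) : Set where
  field
    node        : ℕ → ℕ
    link        : ℕ → ℕ
    node-zero   : node 0 ≡ 0
    node-suc    : ∀ k → node (suc k) ≡ suc (link k)
    link-parent : ∀ k → π₁ (link k) ≡ node k
    node-alive  : ∀ k → T (alive (node (suc k)))

module Tree {A : Set} {E : Language A} (S : Souslin E) where

  -- A node of length d tests only condition π₁ d, and only if its d entries
  -- and the first d letters of x suffice to evaluate it; each condition is
  -- tested at infinitely many lengths.
  test : A ω → ℕ → ℕ ω → Bool
  test x d α = guard (modulus S (π₁ d) ≤? d) (check S (π₁ d) x α)

  alive-at : A ω → List ℕ → Bool
  alive-at x l = test x (length l) (extend l)

  test-stack : ∀ {x} γ d → T (alive-at x (stack γ d)) ≡ T (test x d (extend (stack γ d)))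
  test-stack {x} γ d = cong (λ d′ → T (test x d′ (extend (stack γ d)))) (length-stack γ d)

  alive : A ω → ℕ → Bool
  alive x t = alive-at x (label t)

  -- The depth of node `t` is at most `t`, and the guard admits only a condition whose modulus is at
  -- most the depth.
  alive-local : ∀ {x x′} t → x ≈[ t ] x′ → alive x t ≡ alive x′ t
  alive-local t x≈x′ = guard-cong (modulus S (π₁ d) ≤? d) λ μ≤d →
    local S (π₁ d) (≈-mono (≤-trans μ≤d (entries-length t t)) x≈x′) (λ _ → refl)
    where
    d = length (label t)

  branch : ∀ {x} → E x → Branch (alive x)
  branch {x} e = record
    { node        = v
    ; link        = λ k → pair (v k) (α k)
    ; node-zero   = refl
    ; node-suc    = λ k → refl
    ; link-parent = λ k → π₁-pair (v k) (α k)
    ; node-alive  = λ k → subst (T ∘ alive-at x) (sym (label-v (suc k))) (alive-stack (suc k))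
    }
    where
    α = proj₁ (witness S e)

    v : ℕ → ℕ
    v zero    = 0
    v (suc k) = suc (pair (v k) (α k))

    label-v : ∀ k → label (v k) ≡ stack α k
    label-v zero    = refl
    label-v (suc k) = trans (label-suc (pair (v k) (α k)))
      (cong₂ _∷_ (π₂-pair (v k) (α k)) (trans (cong label (π₁-pair (v k) (α k))) (label-v k)))

    alive-stack : ∀ d → T (alive-at x (stack α d))
    alive-stack d = subst (λ P → P) (sym (test-stack α d))
      (guard-intro (modulus S (π₁ d) ≤? d) λ μ≤d →
        subst T (local S (π₁ d) (λ _ → refl)
                       (λ i<μ → sym (extend-stack α d (<-≤-trans i<μ μ≤d))))
                (proj₂ (witness S e) (π₁ d)))

  -- Condition `j` with modulus `μ` is tested at depth `N = pair j (suc μ)`: `π₁ N` is `j`, and `N`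
  -- is at least `suc μ`, so the guard is passed.
  member-branch : ∀ {x} → Branch (alive x) → E x
  member-branch {x} β = member S γ λ j →
    let μ = modulus S j in
    for-all-pairs {P = λ j k → modulus S j < k → T (check S j x γ)} holds j (suc μ) ≤-refl
    where
    open Branch β

    γ : ℕ ω
    γ k = π₂ (link k)

    label-node : ∀ k → label (node k) ≡ stack γ k
    label-node zero    = cong label node-zero
    label-node (suc k) = trans (cong label (node-suc k)) (trans (label-suc (link k))
      (cong (γ k ∷_) (trans (cong label (link-parent k)) (label-node k))))

    holds : ∀ N → modulus S (π₁ N) < π₂ N → T (check S (π₁ N) x γ)
    holds zero    ()
    holds N@(suc d) μ< =
      subst T (local S (π₁ N) (λ _ → refl)
                 (λ i<μ → extend-stack γ N (<-≤-trans i<μ μ≤N)))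
        (guard-elim (modulus S (π₁ N) ≤? N)
          (subst (λ P → P) (test-stack γ N)
            (subst (T ∘ alive-at x) (label-node N) (node-alive d))) μ≤N)
      where
      μ≤N = <⇒≤ (<-≤-trans μ< (π₂-≤ N))

-- The tree as a word of blocks, and plays on it

-- at t a b u is the place in the block of node t where a letters low, b letters
-- high and u letters up remain to be read before the final letter.
data Position : Set where
  at : (t a b u : ℕ) → Position

-- The block of a node n with parent p has p letters `low` and n - p letters `high`, against which
-- the counters are tested. Then n letters `up` load the emptied first counter with n, the new last
-- selected node.
start : ℕ → Position
start t = at (suc t) (π₁ t) (suc t ∸ π₁ t) (suc t)

next : Position → Position
next (at t (suc a) b       u)       = at t a b u
next (at t zero    (suc b) u)       = at t zero b u
next (at t zero    zero    (suc u)) = at t zero zero u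
next (at t zero    zero    zero)    = start t

position : ℕ → Position
-- The root has no parent, and its block is a final letter alone.
position zero    = at 0 0 0 0
position (suc N) = next (position N)

block : Position → ℕ
block (at t _ _ _) = t

block-next : ∀ P → block (next P) ≤ suc (block P)
block-next (at t (suc a) b       u)       = n≤1+n t
block-next (at t zero    (suc b) u)       = n≤1+n t
block-next (at t zero    zero    (suc u)) = n≤1+n t
block-next (at t zero    zero    zero)    = ≤-refl

-- Each block has at least one letter, its final one.
block-≤ : ∀ N → block (position N) ≤ N
block-≤ zero    = z≤n
block-≤ (suc N) = ≤-trans (block-next (position N)) (s≤s (block-≤ N))

Letter State : Set
Letter = Fin 5
State  = Fin 2

pattern low  = zero
pattern high = suc zero
pattern up   = suc (suc zero)
pattern dead = suc (suc (suc zero))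
pattern live = suc (suc (suc (suc zero)))

pattern skip   = zero
pattern select = suc zero

ending : Bool → Letter
ending true  = live
ending false = dead

letter : (ℕ → Bool) → Position → Letter
letter alive (at t (suc a) b       u)       = low
letter alive (at t zero    (suc b) u)       = high
letter alive (at t zero    zero    (suc u)) = up
letter alive (at t zero    zero    zero)    = ending (alive t)

letter-cong : ∀ {f g : ℕ → Bool} P → f (block P) ≡ g (block P) → letter f P ≡ letter g P
letter-cong (at t (suc a) b       u)       _  = refl
letter-cong (at t zero    (suc b) u)       _  = refl
letter-cong (at t zero    zero    (suc u)) _  = refl
letter-cong (at t zero    zero    zero)    eq = cong ending eq

word : (ℕ → Bool) → Letter ω
word alive N = letter alive (position N)

-- A state with the values of the two counters in use.
Conf : Set
Conf = State × ℕ × ℕ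

-- The state tells whether the current block is selected; the choice for the next block is made at
-- the final letter. There `D` gains one, as the distance to the last selected node grows.
data Step (alive : ℕ → Bool) : Position → Conf → Conf → Set where
  skip-low    : ∀ {t a b u C D} →
    Step alive (at t (suc a) b u) (skip , C , D) (skip , C , D)
  skip-high   : ∀ {t b u C D} →
    Step alive (at t 0 (suc b) u) (skip , C , D) (skip , C , D)
  skip-up     : ∀ {t u C D} →
    Step alive (at t 0 0 (suc u)) (skip , C , D) (skip , C , D)
  skip-end    : ∀ {t q C D} →
    Step alive (at t 0 0 0) (skip , C , D) (q , C , suc D)
  select-low  : ∀ {t a b u C D} →
    Step alive (at t (suc a) b u) (select , suc C , D) (select , C , D)
  select-high : ∀ {t b u C D} →
    Step alive (at t 0 (suc b) u) (select , C , suc D) (select , C , D)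
  select-up   : ∀ {t u C D} →
    Step alive (at t 0 0 (suc u)) (select , C , D) (select , suc C , D)
  select-end  : ∀ {t q C D} → T (alive t) →
    Step alive (at t 0 0 0) (select , C , D) (q , C , suc D)

record AcceptingPlay (alive : ℕ → Bool) : Set where
  field
    conf      : ℕ → Conf
    conf-zero : conf 0 ≡ (skip , 0 , 0)
    conf-step : ∀ N → Step alive (position N) (conf N) (conf (suc N))
    selects   : InfinitelyOften (λ N → proj₁ (conf N) ≡ select)

-- Invariant of a play whose last selected node is i.  While block suc t is
-- selected, C has lost one for each letter low read and gained one for each
-- letter up, and D has lost one for each letter high.  At the end of the
-- letters high this leaves C = i - π₁ t ≥ 0 and D = π₁ t - i ≥ 0, which is
-- how blind counters test i = π₁ t.
data Invariant (i : ℕ) : Position → Conf → Set where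
  skipping  : ∀ {t a b u C D} → C ≡ i → D + i ≡ t →
              Invariant i (at t a b u) (skip , C , D)
  selecting : ∀ {t a b u C D} →
              C + π₁ t + u ≡ i + a + suc t → D + i ≡ π₁ t + b →
              u ≡ suc t ⊎ i ≡ π₁ t →
              Invariant i (at (suc t) a b u) (select , C , D)

entering : ∀ {i t C D} q → C ≡ i → D + i ≡ suc t → Invariant i (start t) (q , C , D)
entering skip C≡i D+i≡ = skipping C≡i D+i≡
entering {t = t} select refl D+i≡ =
  selecting refl (trans D+i≡ (sym (m+[n∸m]≡n (m≤n⇒m≤1+n (π₁-≤ t))))) (inj₁ refl)

-- Before the first `up`, `u` is `suc t` and cancels, leaving `C + π₁ t ≡ i`, while the second
-- equation is `D + i ≡ π₁ t`; the two give both inequalities. Later letters `up` change `C`, so the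
-- result is kept in the disjunction.
tested : ∀ {i t u C D} → Invariant i (at (suc t) 0 0 u) (select , C , D) → i ≡ π₁ t
tested (selecting _ _ (inj₂ i≡p)) = i≡p
tested {i} {t} {u} {C} {D} (selecting eqC eqD (inj₁ refl)) =
  ≤-antisym (m+n≤o⇒n≤o D (≤-reflexive (trans eqD (+-identityʳ _))))
            (m+n≤o⇒n≤o C (≤-reflexive (trans (+-cancelʳ-≡ (suc t) _ _ eqC) (+-identityʳ i))))

-- With `i ≡ π₁ t` and no letters left, the two equations give `C ≡ suc t` and `D ≡ 0`.
ended : ∀ {i t C D} q → Invariant i (at (suc t) 0 0 0) (select , C , D) →
        Invariant (suc t) (start (suc t)) (q , C , suc D)
ended {i} {t} {C} {D} q inv@(selecting eqC eqD _) with refl ← tested inv =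
  entering q
    (+-cancelʳ-≡ (π₁ t) C (suc t) (begin
      C + π₁ t          ≡⟨ +-identityʳ _ ⟨
      C + π₁ t + 0      ≡⟨ eqC ⟩
      π₁ t + 0 + suc t  ≡⟨ cong (_+ suc t) (+-identityʳ _) ⟩
      π₁ t + suc t      ≡⟨ +-comm (π₁ t) _ ⟩
      suc t + π₁ t      ∎))
    (cong (λ d → suc d + suc t) (+-cancelʳ-≡ (π₁ t) D 0 (trans eqD (+-identityʳ _))))
  where open ≡-Reasoning

-- From an accepting play to a branch

module Soundness {alive : ℕ → Bool} (play : AcceptingPlay alive) where

  open AcceptingPlay play

  step-from : ∀ {N P c} → position N ≡ P → conf N ≡ c →
              ∃[ c′ ] position (suc N) ≡ next P × conf (suc N) ≡ c′ × Step alive P c c′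
  step-from {N} refl refl = _ , refl , refl , conf-step N

  Stage : ℕ → Set
  Stage i = ∃[ N ] Invariant i (position N) (conf N)

  stage : ∀ {i P c} N → position N ≡ P → conf N ≡ c → Invariant i P c → Stage i
  stage N refl refl inv = N , inv

  Successor : ℕ → Set
  Successor i = ∃[ t ] π₁ t ≡ i × T (alive (suc t)) × Stage (suc t)

  finish : ∀ {i t C D} a b u N → position N ≡ at t a b u → conf N ≡ (select , C , D) →
           Invariant i (at t a b u) (select , C , D) → Successor i
  finish (suc a) b u N pos eq (selecting {t = t} eqC eqD r) with step-from pos eq
  ... | _ , pos′ , eq′ , select-low {C = C} =
    finish a b u (suc N) pos′ eq′
      (selecting (suc-injective (trans eqC (cong (_+ suc t) (+-suc _ a)))) eqD r)
  finish zero (suc b) u N pos eq (selecting {t = t} eqC eqD r) with step-from pos eq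
  ... | _ , pos′ , eq′ , select-high =
    finish 0 b u (suc N) pos′ eq′ (selecting eqC (suc-injective (trans eqD (+-suc (π₁ t) b))) r)
  finish zero zero (suc u) N pos eq inv@(selecting {t = t} eqC eqD r) with step-from pos eq
  ... | _ , pos′ , eq′ , select-up {C = C} =
    finish 0 0 u (suc N) pos′ eq′
      (selecting (trans (sym (+-suc (C + π₁ t) u)) eqC) eqD (inj₂ (tested inv)))
  finish zero zero zero N pos eq inv@(selecting {t = t} eqC eqD r) with step-from pos eq
  ... | (q , _) , pos′ , eq′ , select-end ok =
    t , sym (tested inv) , ok , stage (suc N) pos′ eq′ (ended q inv)

  -- The Büchi condition provides a selecting time `d` letters ahead, so skipping stops within `d`
  -- steps and `finish` takes over.
  search : ∀ {i} d N → proj₁ (conf (d + N)) ≡ select →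
           Invariant i (position N) (conf N) → Successor i
  search d N sel inv with position N in pos | conf N in eq
  search d       N sel inv | at t a b u | select , _ = finish a b u N pos eq inv
  search zero    N sel inv | _ | skip , _ = case trans (sym (cong proj₁ eq)) sel of λ ()
  search {i} (suc d) N sel inv | P | skip , C , D with step-from pos eq
  ... | c′ , pos′ , eq′ , st =
    search d (suc N) (subst (λ m → proj₁ (conf m) ≡ select) (sym (+-suc d N)) sel)
           (subst₂ (Invariant i) (sym pos′) (sym eq′) (skipped st inv))
    where
    skipped : ∀ {P C D c′} → Step alive P (skip , C , D) c′ →
              Invariant i P (skip , C , D) → Invariant i (next P) c′
    skipped skip-low  (skipping eqC eqD) = skipping eqC eqD
    skipped skip-high (skipping eqC eqD) = skipping eqC eqD
    skipped skip-up   (skipping eqC eqD) = skipping eqC eqD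
    skipped (skip-end {q = q}) (skipping eqC eqD) = entering q eqC (cong suc eqD)

  successor-node : ∀ {i} → Stage i → Successor i
  successor-node (N , inv) =
    let m , m≥N , sel = selects N
    in search (m ∸ N) N (subst (λ k → proj₁ (conf k) ≡ select) (sym (m∸n+n≡m m≥N)) sel) inv

  stages : ℕ → ∃ Stage
  stages zero    = 0 , stage 0 refl conf-zero (skipping refl refl)
  stages (suc k) = let t , _ , _ , s = successor-node (proj₂ (stages k)) in suc t , s

  branch-of-play : Branch alive
  branch-of-play = record
    { node        = λ k → proj₁ (stages k)
    ; link        = λ k → proj₁ (next-node k)
    ; node-zero   = refl
    ; node-suc    = λ k → refl
    ; link-parent = λ k → proj₁ (proj₂ (next-node k))
    ; node-alive  = λ k → proj₁ (proj₂ (proj₂ (next-node k)))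
    }
    where
    next-node = λ k → successor-node (proj₂ (stages k))

-- From a branch to an accepting play

module Completeness {alive : ℕ → Bool} (β : Branch alive) where

  open Branch β

  advance : ∀ {P : Set} → Dec P → ℕ → ℕ
  advance (yes _) k = suc k
  advance (no  _) k = k

  -- The index of the last node of the branch before t, and the node after it.
  rank target : ℕ → ℕ
  rank zero    = 0
  rank (suc t) = advance (t ≟ target t) (rank t)
  target t = node (suc (rank t))

  last : ℕ → ℕ
  last t = node (rank t)

  last-selected : ∀ {t} → t ≡ target t → last (suc t) ≡ t
  last-selected {t} eq with t ≟ target t
  ... | yes _  = sym eq
  ... | no neq = contradiction eq neq

  rank-skipped : ∀ {t} → t ≢ target t → rank (suc t) ≡ rank t
  rank-skipped {t} neq with t ≟ target t
  ... | yes eq = contradiction eq neq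
  ... | no _   = refl

  node-< : ∀ k → node k < node (suc k)
  node-< k rewrite node-suc k | sym (link-parent k) = s≤s (π₁-≤ (link k))

  last-≤ : ∀ t → last t ≤ t
  last-≤ zero = ≤-reflexive node-zero
  last-≤ (suc t) with t ≟ target t
  ... | yes eq = ≤-trans (≤-reflexive (sym eq)) (n≤1+n t)
  ... | no _   = m≤n⇒m≤1+n (last-≤ t)

  -- The target changes only when `t` reaches it, and then to a larger node, as parents come first.
  ≤-target : ∀ t → t ≤ target t
  ≤-target zero = z≤n
  ≤-target (suc t) with t ≟ target t
  ... | yes eq = ≤-trans (s≤s (≤-reflexive eq)) (node-< (suc (rank t)))
  ... | no neq = ≤∧≢⇒< (≤-target t) neq

  -- In a selected block the letters left determine the counters: `C` still has `a` to lose and has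
  -- gained the `t ∸ u` letters `up` already read, and `D` has `b` to lose.
  choose : ∀ {P : Set} → Position → Dec P → Conf
  choose (at t a b u) (yes _) = select , a + (t ∸ u) , b
  choose (at t a b u) (no  _) = skip , last t , t ∸ last t

  conf-at : Position → Conf
  conf-at P = choose P (block P ≟ target (block P))

  Bounded : Position → Set
  Bounded (at t a b u) = u ≤ t

  next-bounded : ∀ P → Bounded P → Bounded (next P)
  next-bounded (at t (suc a) b       u)       u≤t = u≤t
  next-bounded (at t zero    (suc b) u)       u≤t = u≤t
  next-bounded (at t zero    zero    (suc u)) u≤t = <⇒≤ u≤t
  next-bounded (at t zero    zero    zero)    _   = ≤-refl

  position-bounded : ∀ N → Bounded (position N)
  position-bounded zero    = z≤n
  position-bounded (suc N) = next-bounded (position N) (position-bounded N)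

  -- Both clauses of `choose` give the same counters where a block starts, because the parent of a
  -- selected node is the last selected one. So a final letter can lead into either state.
  start-conf : ∀ t → ∃[ q ] conf-at (start t) ≡ (q , last (suc t) , suc t ∸ last (suc t))
  start-conf t with suc t ≟ target (suc t)
  ... | no _   = skip , refl
  ... | yes eq = select , cong₂ (λ c d → select , c , d)
    (trans (cong (π₁ t +_) (n∸n≡0 (suc t))) (trans (+-identityʳ _) parent))
    (cong (suc t ∸_) parent)
    where
    parent : π₁ t ≡ last (suc t)
    parent = trans (cong π₁ (suc-injective (trans eq (node-suc (rank (suc t))))))
                   (link-parent (rank (suc t)))

  step-at : ∀ P → Bounded P → Step alive P (conf-at P) (conf-at (next P))
  step-at (at t (suc a) b u) _ with t ≟ target t
  ... | yes _ = select-low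
  ... | no  _ = skip-low
  step-at (at t zero (suc b) u) _ with t ≟ target t
  ... | yes _ = select-high
  ... | no  _ = skip-high
  step-at (at t zero zero (suc u)) u<t with t ≟ target t
  -- As `u < t`, one more `up` turns `t ∸ suc u` into `t ∸ u`.
  ... | yes _ = subst (λ c → Step alive (at t 0 0 (suc u)) (select , t ∸ suc u , 0) (select , c , 0))
                      (sym (+-∸-assoc 1 u<t)) select-up
  ... | no  _ = skip-up
  step-at (at t zero zero zero) _ with start-conf t | last-selected {t} | rank-skipped {t}
  ... | q , eq | sel | skp with t ≟ target t
  ...   | yes t≡ = subst (Step alive _ _) (sym (trans eq (cong₂ (λ c d → q , c , d) (sel t≡)
                     (trans (cong (suc t ∸_) (sel t≡)) (m+n∸n≡m 1 t)))))
                     (select-end (subst (T ∘ alive) (sym t≡) (node-alive (rank t))))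
  ...   | no t≢  = subst (Step alive _ _) (sym (trans eq (cong₂ (λ c d → q , c , d) (cong node (skp t≢))
                     (trans (cong (λ k → suc t ∸ node k) (skp t≢)) (+-∸-assoc 1 (last-≤ t))))))
                     skip-end

  reach-end : ∀ t a b u N → position N ≡ at t a b u → ∃[ M ] position M ≡ at t 0 0 0
  reach-end t (suc a) b       u       N eq = reach-end t a b u (suc N) (cong next eq)
  reach-end t zero    (suc b) u       N eq = reach-end t 0 b u (suc N) (cong next eq)
  reach-end t zero    zero    (suc u) N eq = reach-end t 0 0 u (suc N) (cong next eq)
  reach-end t zero    zero    zero    N eq = N , eq

  block-end : ∀ t → ∃[ N ] position N ≡ at t 0 0 0
  block-end zero    = 0 , refl
  block-end (suc t) = let N , eq = block-end t in
    reach-end (suc t) (π₁ t) (suc t ∸ π₁ t) (suc t) (suc N) (cong next eq)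

  -- The target stays fixed while nodes are skipped, so its distance `d` drops to 0.
  selected-after : ∀ d t → d + t ≡ target t → ∃[ s ] t ≤ s × s ≡ target s
  selected-after zero    t eq = t , ≤-refl , eq
  selected-after (suc d) t eq =
    let s , t<s , sel = selected-after d (suc t) (trans (+-suc d t) (trans eq
          (cong (node ∘ suc) (sym (rank-skipped (λ t≡ → <⇒≢ (s≤s (m≤n+m t d)) (trans t≡ (sym eq))))))))
    in s , <⇒≤ t<s , sel

  selected-conf : ∀ {t} N → position N ≡ at t 0 0 0 → t ≡ target t →
                  proj₁ (conf-at (position N)) ≡ select
  selected-conf {t} N pos eq rewrite pos with t ≟ target t
  ... | yes _  = refl
  ... | no neq = contradiction eq neq

  play-of-branch : AcceptingPlay alive
  play-of-branch = record
    { conf      = conf-at ∘ position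
    ; conf-zero = initial-conf
    ; conf-step = λ N → step-at (position N) (position-bounded N)
    ; selects   = λ n →
        let s , n≤s , sel = selected-after (target n ∸ n) n (m∸n+n≡m (≤-target n))
            N , pos = block-end s
        in N , ≤-trans n≤s (subst (_≤ N) (cong block pos) (block-≤ N)) , selected-conf N pos sel
    }
    where
    initial-conf : conf-at (at 0 0 0 0) ≡ (skip , 0 , 0)
    initial-conf with 0 ≟ target 0
    ... | yes 0≡ = contradiction (trans 0≡ (node-suc 0)) λ ()
    ... | no  _  = cong₂ (λ c d → skip , c , d) node-zero (0∸n≡0 (node 0))

-- The automaton

_≟ᵐ_ : DecidableEquality Move
stay ≟ᵐ stay = yes refl
stay ≟ᵐ inc  = no λ ()
stay ≟ᵐ dec  = no λ ()
inc  ≟ᵐ stay = no λ ()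
inc  ≟ᵐ inc  = yes refl
inc  ≟ᵐ dec  = no λ ()
dec  ≟ᵐ stay = no λ ()
dec  ≟ᵐ inc  = no λ ()
dec  ≟ᵐ dec  = yes refl

effect : State → Letter → Vec Move 4
effect skip   low  = stay ∷ stay ∷ stay ∷ stay ∷ []
effect skip   high = stay ∷ stay ∷ stay ∷ stay ∷ []
effect skip   up   = stay ∷ stay ∷ stay ∷ stay ∷ []
effect skip   dead = stay ∷ inc  ∷ stay ∷ stay ∷ []
effect skip   live = stay ∷ inc  ∷ stay ∷ stay ∷ []
effect select low  = dec  ∷ stay ∷ stay ∷ stay ∷ []
effect select high = stay ∷ dec  ∷ stay ∷ stay ∷ []
effect select up   = inc  ∷ stay ∷ stay ∷ stay ∷ []
effect select dead = stay ∷ inc  ∷ stay ∷ stay ∷ []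
effect select live = stay ∷ inc  ∷ stay ∷ stay ∷ []

allowed : State → Letter → State → Bool
allowed select dead q′ = false
allowed skip   dead q′ = true
allowed q      live q′ = true
allowed q      _    q′ = isYes (q ≟ᶠ q′)

Respects : Vec Bool 4 → Vec Move 4 → Set
Respects i j = ∀ m → lookup i m ≡ false → lookup j m ≢ dec

-- `Respects` makes `no-dec-at-zero` part of the relation. It survives raising an entry of `i` to
-- `true`, which gives `blind`.
Transition : State → Letter → Vec Bool 4 → State → Vec Move 4 → Set
Transition q a i q′ j = j ≡ effect q a × T (allowed q a q′) × Respects i j

transition? : ∀ q a i q′ j → Dec (Transition q a i q′ j)
transition? q a i q′ j =
  ≡-dec _≟ᵐ_ j (effect q a) ×-dec T? (allowed q a q′) ×-dec
  all? (λ m → (lookup i m ≟ᵇ false) →-dec ¬? (lookup j m ≟ᵐ dec))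

machine : Machine 4 5
machine = record
  { states = 2
  ; q₀     = skip
  ; Δ      = λ q a i q′ j → isYes (transition? q a i q′ j)
  ; no-dec-at-zero = λ t → proj₂ (proj₂ (toWitness t))
  ; blind  = λ {q} {a} {i} {q′} {j} t m _ →
      let e , al , resp = toWitness t in
      fromWitness {a? = transition? q a (i [ m ]≔ true) q′ j}
        (e , al , λ m′ z → resp m′ (unset i m m′ z))
  }
  where
  unset : ∀ (i : Vec Bool 4) m m′ → lookup (i [ m ]≔ true) m′ ≡ false → lookup i m′ ≡ false
  unset i m m′ z with m′ ≟ᶠ m
  ... | yes refl = contradiction (trans (sym (lookup∘update m i true)) z) λ ()
  ... | no m′≢m  = trans (sym (lookup∘update′ m′≢m i true)) z

automaton : BüchiAutomaton 4 5
automaton = record { machine = machine ; F = ⁅ select ⁆ }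

open BüchiAutomaton automaton using (Configuration; IsRun; _∶_↦_; accepted; positive)

configuration : Conf → Configuration
configuration (q , C , D) = q , C ∷ D ∷ 0 ∷ 0 ∷ []

observe : Configuration → Conf
observe (q , c) = q , lookup c zero , lookup c (suc zero)

↦-from : ∀ {C D C′ D′} q q′ a (j₀ j₁ : Move) → effect q a ≡ j₀ ∷ j₁ ∷ stay ∷ stay ∷ [] →
         T (allowed q a q′) → Shift j₀ C C′ → Shift j₁ D D′ →
         a ∶ configuration (q , C , D) ↦ configuration (q′ , C′ , D′)
↦-from {C} {D} q q′ a j₀ j₁ eff ok s₀ s₁ = j₀ ∷ j₁ ∷ stay ∷ stay ∷ [] ,
  fromWitness {a? = transition? q a (map positive (C ∷ D ∷ 0 ∷ 0 ∷ [])) q′ _}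
    (sym eff , ok , respects) , λ where
    zero                   → unshift j₀ s₀
    (suc zero)             → unshift j₁ s₁
    (suc (suc zero))       → refl
    (suc (suc (suc zero))) → refl
  where
  nonzero : ∀ {j c c′} → Shift j c c′ → positive c ≡ false → j ≢ dec
  nonzero refl () refl

  respects : Respects (map positive (C ∷ D ∷ 0 ∷ 0 ∷ [])) (j₀ ∷ j₁ ∷ stay ∷ stay ∷ [])
  respects zero                   = nonzero s₀
  respects (suc zero)             = nonzero s₁
  respects (suc (suc zero))       _ ()
  respects (suc (suc (suc zero))) _ ()

step⇒↦ : ∀ {alive P c c′} → Step alive P c c′ →
         letter alive P ∶ configuration c ↦ configuration c′
step⇒↦ skip-low    = ↦-from skip skip low  stay stay refl tt refl refl
step⇒↦ skip-high   = ↦-from skip skip high stay stay refl tt refl refl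
step⇒↦ skip-up     = ↦-from skip skip up   stay stay refl tt refl refl
step⇒↦ {alive} (skip-end {t} {q}) with alive t
... | true  = ↦-from skip q live stay inc refl tt refl refl
... | false = ↦-from skip q dead stay inc refl tt refl refl
step⇒↦ select-low  = ↦-from select select low  dec stay refl tt refl refl
step⇒↦ select-high = ↦-from select select high stay dec refl tt refl refl
step⇒↦ select-up   = ↦-from select select up   inc stay refl tt refl refl
step⇒↦ {alive} (select-end {t} {q} ok) with alive t
... | true  = ↦-from select q live stay inc refl tt refl refl

↦⇒shifts : ∀ a q c q′ c′ → a ∶ (q , c) ↦ (q′ , c′) → T (allowed q a q′) ×
           Shift (lookup (effect q a) zero) (lookup c zero) (lookup c′ zero) ×
           Shift (lookup (effect q a) (suc zero)) (lookup c (suc zero)) (lookup c′ (suc zero))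
↦⇒shifts a q c q′ c′ (j , δ , moves) with toWitness {a? = transition? q a (map positive c) q′ j} δ
... | refl , ok , _ = ok , shift _ (moves zero) , shift _ (moves (suc zero))

step-from-shifts : ∀ {alive} P q {q′ C D C′ D′} → let a = letter alive P in
                   T (allowed q a q′) →
                   Shift (lookup (effect q a) zero) C C′ →
                   Shift (lookup (effect q a) (suc zero)) D D′ →
                   Step alive P (q , C , D) (q′ , C′ , D′)
step-from-shifts (at t (suc a) b u)       skip   {skip}   _ refl refl = skip-low
step-from-shifts (at t zero (suc b) u)    skip   {skip}   _ refl refl = skip-high
step-from-shifts (at t zero zero (suc u)) skip   {skip}   _ refl refl = skip-up
step-from-shifts {alive} (at t zero zero zero) skip ok s₀ s₁ with alive t
step-from-shifts (at t zero zero zero)    skip   _ refl refl | true  = skip-end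
step-from-shifts (at t zero zero zero)    skip   _ refl refl | false = skip-end
step-from-shifts (at t (suc a) b u)       select {select} _ refl refl = select-low
step-from-shifts (at t zero (suc b) u)    select {select} _ refl refl = select-high
step-from-shifts (at t zero zero (suc u)) select {select} _ refl refl = select-up
-- If node `t` is not alive, the letter is `dead`, which `allowed` refuses in state `select`.
step-from-shifts {alive} (at t zero zero zero) select ok s₀ s₁ with alive t in eq
step-from-shifts (at t zero zero zero)    select _ refl refl | true = select-end (subst T (sym eq) tt)

accepted⇒play : ∀ {alive} → accepted (word alive) → AcceptingPlay alive
accepted⇒play {alive} (r , (r₀ , steps) , q , q∈F , often) = record
  { conf      = observe ∘ r
  ; conf-zero = cong observe r₀
  ; conf-step = λ N →
      let ok , s₀ , s₁ = ↦⇒shifts (word alive N) _ (proj₂ (r N)) _ (proj₂ (r (suc N))) (steps N)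
      in step-from-shifts (position N) (proj₁ (r N)) ok s₀ s₁
  ; selects   = λ n → let m , m≥n , eq = often n in m , m≥n , trans eq (x∈⁅y⁆⇒x≡y select q∈F)
  }

play⇒accepted : ∀ {alive} → AcceptingPlay alive → accepted (word alive)
play⇒accepted play = configuration ∘ conf ,
  (cong configuration conf-zero , λ N → step⇒↦ (conf-step N)) ,
  select , x∈⁅x⁆ select , selects
  where open AcceptingPlay play

-- The continuous reduction and completeness

module Reduction {m} {E : Language (Fin m)} (S : Souslin E) where

  open Tree S

  reduction : Fin m ω → Fin 5 ω
  reduction x = word (alive x)

  -- The letter at `N` concerns a node numbered at most `N`, whose liveness depends on at most `N`
  -- letters of `x`; so the identity is a modulus.
  reduction-continuous : Continuous reduction
  reduction-continuous x n = n , λ y eq → ≈⇒prefix n λ {N} N<n →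
    letter-cong (position N)
      (alive-local _ (≈-mono (≤-trans (block-≤ N) (<⇒≤ N<n)) (prefix⇒≈ n eq)))

  reduces : E ≐ (reduction ⊢ BüchiAutomaton.accepted automaton)
  reduces = (λ e → play⇒accepted (Completeness.play-of-branch (branch e))) ,
            (λ a → member-branch (Soundness.branch-of-play (accepted⇒play a)))

corollary4p16 : Σ[ n ∈ ℕ ] Σ[ L ∈ Language (Fin n) ] (r-BCL[ 4 ]ω L × Σ¹₁-Complete L)
corollary4p16 = 5 , BüchiAutomaton.accepted automaton ,
  (automaton , (λ a → a) , (λ a → a)) , λ E → mk⇔
    (λ analytic → let open Reduction (analytic⇒souslin analytic) in
       reduction , reduction-continuous , reduces)
    (λ (f , f-continuous , E≐) →
       analytic-respects-≐ E≐ (Runs.analytic-preimage automaton f f-continuous))
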